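{- Let $p,q\in\mathbb{N}$ be coprime, $k\in\mathbb{N}$ squarefree, $m=-pk$, $n=qk$, and let $P\in E(m,n)(\mathbb{Q})$ be a rational point which is neither the neutral element nor one of the three points of order $2$. Let $(X_0:X_1:X_2:X_3)=\psi(P)\in Q(m,n)(\mathbb{Q})$ (so $X_1\neq0$), put $\alpha=X_2/X_1$, $\beta=X_0/X_1$, $\gamma=X_3/X_1$, so that $\alpha^2=\beta^2-pk$ and $\gamma^2=\beta^2+qk$ (the associated triple of rational squares $\alpha^2\le\beta^2<\gamma^2$ in arithmetic progression of step $k$), and let $\Delta$ be the triangle with sides $a=|\gamma|+|\alpha|$, $b=|\gamma|-|\alpha|$, $c=2|\beta|$, whose angle $\theta$ between the sides $a$ and $b$ satisfies $\cos\theta=(q-p)/(q+p)$. Then the following are equivalent: (i) $P$ has order $4$; (ii) $\alpha^2=0$, i.e. the triple of squares contains $0$; (iii) $a=b$, i.e. $\Delta$ is isosceles with the angle $\theta$ between its two equal sides.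
   Context: $E(m,n)$ is the elliptic curve $y^2=x(x+m)(x+n)$ (projectively $Y^2T=X(X+mT)(X+nT)$ with coordinates $(T:X:Y)$), with neutral element the point at infinity and points of order 2 $(0,0),(-m,0),(-n,0)$. $Q(m,n)\subset\mathbb{P}^3$ is the curve $X_0^2+mX_1^2=X_2^2,\ X_0^2+nX_1^2=X_3^2$. $\psi:E(m,n)\to Q(m,n)$ is the isomorphism of curves extending the rational map $(T:X:Y)\mapsto\bigl(-(X+mT)(Y^2-m(X+nT)^2) : 2Y(X+nT)(X+mT) : -(X+mT)(Y^2+m(X+nT)^2) : -(X+nT)(Y^2+n(X+mT)^2)\bigr)$; it maps the neutral element and the three points of order 2 to the points $(1:0:\pm1:\pm1)$ and all other rational points to points with $X_1\neq0$. -}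

module Defs where

import Data.Integer.Base as ℤ
open import Data.Nat.Base as ℕ using (ℕ; zero; suc)
open import Data.Nat.Divisibility using (_∣_)
open import Data.Nat.Properties using (m≤n⇒m≤o+n)
open import Data.Product.Base using (Σ-syntax; _×_; _,_)
open import Data.Rational.Base
open import Data.Rational.Properties
open import Data.Rational.Solver using (module +-*-Solver)
open import Relation.Binary.PropositionalEquality
open import Relation.Nullary using (¬_; yes; no)

open +-*-Solver using (solve; _:=_; _:+_; _:*_; :-_; _:-_; con)

private
  cancel : ∀ r x → r ≢ 0ℚ → r * x ≡ 0ℚ → x ≡ 0ℚ
  cancel r x r≢0 rx≡0 = begin
    x                ≡⟨ *-identityˡ x ⟨
    1ℚ * x           ≡⟨ cong (_* x) (*-inverseˡ r) ⟨
    (1/ r) * r * x   ≡⟨ *-assoc (1/ r) r x ⟩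
    (1/ r) * (r * x) ≡⟨ cong ((1/ r) *_) rx≡0 ⟩
    (1/ r) * 0ℚ      ≡⟨ *-zeroʳ (1/ r) ⟩
    0ℚ               ∎
    where
    open ≡-Reasoning
    instance _ = ≢-nonZero r≢0

  *-≢0 : ∀ r x → r ≢ 0ℚ → x ≢ 0ℚ → r * x ≢ 0ℚ
  *-≢0 r x r≢0 x≢0 rx≡0 = x≢0 (cancel r x r≢0 rx≡0)

  ÷-* : ∀ x y .{{_ : NonZero y}} → (x ÷ y) * y ≡ x
  ÷-* x y = begin
    x * (1/ y) * y   ≡⟨ *-assoc x (1/ y) y ⟩
    x * ((1/ y) * y) ≡⟨ cong (x *_) (*-inverseˡ y) ⟩
    x * 1ℚ           ≡⟨ *-identityʳ x ⟩
    x                ∎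
    where open ≡-Reasoning

  -≡0⇒≡ : ∀ x y → x - y ≡ 0ℚ → x ≡ y
  -≡0⇒≡ x y e = begin
    x           ≡⟨ solve 2 (λ a b → a := (a :- b) :+ b) refl x y ⟩
    (x - y) + y ≡⟨ cong (_+ y) e ⟩
    0ℚ + y      ≡⟨ +-identityˡ y ⟩
    y           ∎
    where open ≡-Reasoning

  ≡⇒-≡0 : ∀ {x y} → x ≡ y → x - y ≡ 0ℚ
  ≡⇒-≡0 {x} refl = +-inverseʳ x

  +≡0⇒≡- : ∀ x y → x + y ≡ 0ℚ → x ≡ - y
  +≡0⇒≡- x y e = -≡0⇒≡ x (- y) (trans (solve 2 (λ a b → a :- (:- b) := a :+ b) refl x y) e)

2ℚ 3ℚ : ℚ
2ℚ = ℤ.+ 2 / 1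
3ℚ = ℤ.+ 3 / 1

fromℕ : ℕ → ℚ
fromℕ n = ℤ.+ n / 1

Squarefree : ℕ → Set
Squarefree k = ∀ d → d ℕ.* d ∣ k → d ≡ 1

OnE : (m n x y : ℚ) → Set
OnE m n x y = y * y ≡ x * (x + m) * (x + n)

-- The rational points. The equation is irrelevant, so _≡_ on points is
-- equality of coordinates.
data E (m n : ℚ) : Set where
  ∞   : E m n
  aff : (x y : ℚ) → .(OnE m n x y) → E m n

module _ {m n : ℚ} where

  -- The chord or tangent y = y₁ + s (x - x₁) meets the curve in a third
  -- point of abscissa s² - (m + n) - x₁ - x₂ (compare the coefficients
  -- of x²); the sum is the reflection of that point.
  sumX : (x₁ x₂ s : ℚ) → ℚ
  sumX x₁ x₂ s = s * s - (m + n) - x₁ - x₂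

  sumY : (x₁ x₂ y₁ s : ℚ) → ℚ
  sumY x₁ x₂ y₁ s = s * (x₁ - sumX x₁ x₂ s) - y₁

  chordSlope : (x₁ y₁ x₂ y₂ : ℚ) → x₁ ≢ x₂ → ℚ
  chordSlope x₁ y₁ x₂ y₂ x₁≢x₂ = ((y₂ - y₁) ÷ (x₂ - x₁))
    {{≢-nonZero (λ e → x₁≢x₂ (sym (-≡0⇒≡ x₂ x₁ e)))}}

  -- Implicit differentiation of y² = x³ + (m + n) x² + m n x.
  tangentSlope : (x y : ℚ) → .(y ≢ 0ℚ) → ℚ
  tangentSlope x y y≢0 =
    ((3ℚ * x * x + 2ℚ * (m + n) * x + m * n) ÷ (2ℚ * y))
      {{≢-nonZero (*-≢0 2ℚ y (λ ()) y≢0)}}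

  private
    chord-OnE : ∀ x₁ y₁ x₂ y₂ (x₁≢x₂ : x₁ ≢ x₂) → OnE m n x₁ y₁ → OnE m n x₂ y₂ →
      let s = chordSlope x₁ y₁ x₂ y₂ x₁≢x₂ in OnE m n (sumX x₁ x₂ s) (sumY x₁ x₂ y₁ s)
    chord-OnE x₁ y₁ x₂ y₂ x₁≢x₂ h₁ h₂ = -≡0⇒≡ _ _ (cancel (x₂ - x₁) _ d≢0 (begin
      (x₂ - x₁) * (y₃ * y₃ - x₃ * (x₃ + m) * (x₃ + n))
        ≡⟨ solve 6 (λ m n x₁ x₂ y₁ s →
             let x₃ = s :* s :- (m :+ n) :- x₁ :- x₂
                 y₃ = s :* (x₁ :- x₃) :- y₁
                 L  = y₁ :+ s :* (x₂ :- x₁)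
             in (x₂ :- x₁) :* (y₃ :* y₃ :- x₃ :* (x₃ :+ m) :* (x₃ :+ n))
                := (L :* L :- x₂ :* (x₂ :+ m) :* (x₂ :+ n)) :* (x₃ :- x₁)
                   :- (y₁ :* y₁ :- x₁ :* (x₁ :+ m) :* (x₁ :+ n)) :* (x₃ :- x₂))
             refl m n x₁ x₂ y₁ s ⟩
      (L * L - x₂ * (x₂ + m) * (x₂ + n)) * (x₃ - x₁)
        - (y₁ * y₁ - x₁ * (x₁ + m) * (x₁ + n)) * (x₃ - x₂)
        ≡⟨ cong₂ (λ u v → u * (x₃ - x₁) - v * (x₃ - x₂))
             (≡⇒-≡0 (trans (cong₂ _*_ L≡y₂ L≡y₂) h₂)) (≡⇒-≡0 h₁) ⟩
      0ℚ * (x₃ - x₁) - 0ℚ * (x₃ - x₂)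
        ≡⟨ cong₂ _-_ (*-zeroˡ (x₃ - x₁)) (*-zeroˡ (x₃ - x₂)) ⟩
      0ℚ ∎))
      where
      open ≡-Reasoning
      d≢0 : x₂ - x₁ ≢ 0ℚ
      d≢0 e = x₁≢x₂ (sym (-≡0⇒≡ x₂ x₁ e))
      s  = chordSlope x₁ y₁ x₂ y₂ x₁≢x₂
      x₃ = sumX x₁ x₂ s
      y₃ = sumY x₁ x₂ y₁ s
      L  = y₁ + s * (x₂ - x₁)
      L≡y₂ : L ≡ y₂
      L≡y₂ = trans (cong (y₁ +_) (÷-* (y₂ - y₁) (x₂ - x₁) {{≢-nonZero d≢0}}))
                   (solve 2 (λ a b → a :+ (b :- a) := b) refl y₁ y₂)

    tangent-OnE : ∀ x y (y≢0 : y ≢ 0ℚ) → OnE m n x y →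
      let s = tangentSlope x y y≢0 in OnE m n (sumX x x s) (sumY x x y s)
    tangent-OnE x y y≢0 h = -≡0⇒≡ _ _ (begin
      y₃ * y₃ - x₃ * (x₃ + m) * (x₃ + n)
        ≡⟨ solve 5 (λ m n x y s →
             let x₃ = s :* s :- (m :+ n) :- x :- x
                 y₃ = s :* (x :- x₃) :- y
             in y₃ :* y₃ :- x₃ :* (x₃ :+ m) :* (x₃ :+ n)
                := (y :* y :- x :* (x :+ m) :* (x :+ n))
                   :+ (s :* (con 2ℚ :* y)
                       :- (con 3ℚ :* x :* x :+ con 2ℚ :* (m :+ n) :* x :+ m :* n)) :* (x₃ :- x))
             refl m n x y s ⟩
      (y * y - x * (x + m) * (x + n))
        + (s * (2ℚ * y) - (3ℚ * x * x + 2ℚ * (m + n) * x + m * n)) * (x₃ - x)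
        ≡⟨ cong₂ (λ u v → u + v * (x₃ - x)) (≡⇒-≡0 h)
             (≡⇒-≡0 (÷-* (3ℚ * x * x + 2ℚ * (m + n) * x + m * n) (2ℚ * y)
                          {{≢-nonZero (*-≢0 2ℚ y (λ ()) y≢0)}})) ⟩
      0ℚ + 0ℚ * (x₃ - x) ≡⟨ cong (0ℚ +_) (*-zeroˡ (x₃ - x)) ⟩
      0ℚ ∎)
      where
      open ≡-Reasoning
      s  = tangentSlope x y y≢0
      x₃ = sumX x x s
      y₃ = sumY x x y s

    double-y≢0 : ∀ {x₁ y₁ x₂ y₂} → OnE m n x₁ y₁ → OnE m n x₂ y₂ →
      x₁ ≡ x₂ → y₁ ≢ - y₂ → y₁ ≢ 0ℚ
    double-y≢0 {y₂ = y₂} h₁ h₂ refl y₁≢-y₂ refl with y₂ ≟ 0ℚ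
    ... | yes refl  = y₁≢-y₂ refl
    ... | no  y₂≢0 = *-≢0 y₂ y₂ y₂≢0 y₂≢0 (trans h₂ (sym h₁))

  infixl 6 _⊕_

  _⊕_ : E m n → E m n → E m n
  ∞ ⊕ Q = Q
  P@(aff _ _ _) ⊕ ∞ = P
  aff x₁ y₁ h₁ ⊕ aff x₂ y₂ h₂ with x₁ ≟ x₂
  ... | no x₁≢x₂ =
        let s = chordSlope x₁ y₁ x₂ y₂ x₁≢x₂
        in aff (sumX x₁ x₂ s) (sumY x₁ x₂ y₁ s) (chord-OnE x₁ y₁ x₂ y₂ x₁≢x₂ h₁ h₂)
  ... | yes x₁≡x₂ with y₁ ≟ - y₂
  ...   | yes _      = ∞
  ...   | no y₁≢-y₂ =
          let s = tangentSlope x₁ y₁ (double-y≢0 h₁ h₂ x₁≡x₂ y₁≢-y₂)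
          in aff (sumX x₁ x₁ s) (sumY x₁ x₁ y₁ s)
                 (tangent-OnE x₁ y₁ (double-y≢0 h₁ h₂ x₁≡x₂ y₁≢-y₂) h₁)

  infixr 7 _·_

  _·_ : ℕ → E m n → E m n
  zero  · P = ∞
  suc j · P = P ⊕ j · P

  HasOrder : E m n → ℕ → Set
  HasOrder P d = 0 ℕ.< d × d · P ≡ ∞ × (∀ j → 0 ℕ.< j → j ℕ.< d → j · P ≢ ∞)

module _ (m n : ℚ) where

  T₀ Tₘ Tₙ : E m n
  T₀ = aff 0ℚ 0ℚ (sym (trans (cong (_* (0ℚ + n)) (*-zeroˡ (0ℚ + m))) (*-zeroˡ (0ℚ + n))))
  Tₘ = aff (- m) 0ℚ
    (solve 2 (λ m n → con 0ℚ := (:- m) :* ((:- m) :+ m) :* ((:- m) :+ n)) refl m n)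
  Tₙ = aff (- n) 0ℚ
    (solve 2 (λ m n → con 0ℚ := (:- n) :* ((:- n) :+ m) :* ((:- n) :+ n)) refl m n)

record Q (m n : ℚ) : Set where
  constructor mkQ
  field
    X₀ X₁ X₂ X₃ : ℚ
    .nonzero : ¬ (X₀ ≡ 0ℚ × X₁ ≡ 0ℚ × X₂ ≡ 0ℚ × X₃ ≡ 0ℚ)
    .eqₘ     : X₀ * X₀ + m * (X₁ * X₁) ≡ X₂ * X₂
    .eqₙ     : X₀ * X₀ + n * (X₁ * X₁) ≡ X₃ * X₃

infix 4 _≈_

-- Equality of points of ℙ³: proportional homogeneous coordinates.
_≈_ : ∀ {m n} → Q m n → Q m n → Set
X ≈ Y = Σ[ t ∈ ℚ ] t ≢ 0ℚ ×
  X.X₀ ≡ t * Y.X₀ × X.X₁ ≡ t * Y.X₁ × X.X₂ ≡ t * Y.X₂ × X.X₃ ≡ t * Y.X₃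
  where
  module X = Q X
  module Y = Q Y

module _ (m n : ℚ) where

  -- The rational map at (T : X : Y) = (1 : x : y).
  ψ₀ ψ₁ ψ₂ ψ₃ : (x y : ℚ) → ℚ
  ψ₀ x y = - (x + m) * (y * y - m * ((x + n) * (x + n)))
  ψ₁ x y = 2ℚ * y * (x + n) * (x + m)
  ψ₂ x y = - (x + m) * (y * y + m * ((x + n) * (x + n)))
  ψ₃ x y = - (x + n) * (y * y + n * ((x + m) * (x + m)))

  private
    ψ-eqₘ : ∀ x y → ψ₀ x y * ψ₀ x y + m * (ψ₁ x y * ψ₁ x y) ≡ ψ₂ x y * ψ₂ x y
    ψ-eqₘ = solve 4 (λ m n x y →
      let p₀ = (:- (x :+ m)) :* (y :* y :- m :* ((x :+ n) :* (x :+ n)))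
          p₁ = con 2ℚ :* y :* (x :+ n) :* (x :+ m)
          p₂ = (:- (x :+ m)) :* (y :* y :+ m :* ((x :+ n) :* (x :+ n)))
      in p₀ :* p₀ :+ m :* (p₁ :* p₁) := p₂ :* p₂) refl m n

    ψ-eqₙ : ∀ x y → OnE m n x y →
      ψ₀ x y * ψ₀ x y + n * (ψ₁ x y * ψ₁ x y) ≡ ψ₃ x y * ψ₃ x y
    ψ-eqₙ x y h = -≡0⇒≡ _ _ (begin
      ψ₀ x y * ψ₀ x y + n * (ψ₁ x y * ψ₁ x y) - ψ₃ x y * ψ₃ x y
        ≡⟨ solve 5 (λ m n x y z →
             let u  = x :+ m
                 v  = x :+ n
                 p₀ = (:- u) :* (z :- m :* (v :* v))
                 p₁ = con 2ℚ :* y :* v :* u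
                 p₃ = (:- v) :* (z :+ n :* (u :* u))
             in p₀ :* p₀ :+ n :* (p₁ :* p₁) :- p₃ :* p₃
                := (p₀ :* p₀ :- (v :* (z :- n :* (u :* u))) :* (v :* (z :- n :* (u :* u))))
                   :+ con 2ℚ :* con 2ℚ :* n :* (u :* u) :* (v :* v) :* (y :* y :- z))
             refl m n x y (y * y) ⟩
      (F (y * y) - G (y * y) * G (y * y)) + c * (y * y - y * y)
        ≡⟨ cong₂ (λ z w → (F z - G z * G z) + c * w) h (+-inverseʳ (y * y)) ⟩
      (F z - G z * G z) + c * 0ℚ
        ≡⟨ cong₂ _+_
             (solve 4 (λ m n x c →
               let u  = x :+ m
                   v  = x :+ n
                   z  = x :* u :* v
                   p₀ = (:- u) :* (z :- m :* (v :* v))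
                   g  = v :* (z :- n :* (u :* u))
               in p₀ :* p₀ :- g :* g := con 0ℚ) refl m n x c)
             (*-zeroʳ c) ⟩
      0ℚ ∎)
      where
      open ≡-Reasoning
      z = x * (x + m) * (x + n)
      F G : ℚ → ℚ
      F z = (- (x + m) * (z - m * ((x + n) * (x + n)))) * (- (x + m) * (z - m * ((x + n) * (x + n))))
      G z = (x + n) * (z - n * ((x + m) * (x + m)))
      c = 2ℚ * 2ℚ * n * ((x + m) * (x + m)) * ((x + n) * (x + n))

    ψ-nonzero : ∀ x y → OnE m n x y → x ≢ - m → x ≢ - n →
      ¬ (ψ₀ x y ≡ 0ℚ × ψ₁ x y ≡ 0ℚ × ψ₂ x y ≡ 0ℚ × ψ₃ x y ≡ 0ℚ)
    ψ-nonzero x y h x≢-m x≢-n (e₀ , e₁ , _) with y ≟ 0ℚ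
    ... | no y≢0 =
      *-≢0 (2ℚ * y * (x + n)) (x + m) (*-≢0 (2ℚ * y) (x + n) (*-≢0 2ℚ y (λ ()) y≢0) v≢0) u≢0 e₁
      where
      u≢0 : x + m ≢ 0ℚ
      u≢0 e = x≢-m (+≡0⇒≡- x m e)
      v≢0 : x + n ≢ 0ℚ
      v≢0 e = x≢-n (+≡0⇒≡- x n e)
    ... | yes refl with x ≟ 0ℚ
    ...   | no x≢0 = *-≢0 (x * (x + m)) (x + n) (*-≢0 x (x + m) x≢0 u≢0) v≢0 (sym h)
      where
      u≢0 : x + m ≢ 0ℚ
      u≢0 e = x≢-m (+≡0⇒≡- x m e)
      v≢0 : x + n ≢ 0ℚ
      v≢0 e = x≢-n (+≡0⇒≡- x n e)
    ...   | yes refl = *-≢0 (m * m) (n * n) (*-≢0 m m m≢0 m≢0) (*-≢0 n n n≢0 n≢0)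
      (trans (solve 2 (λ m n → m :* m :* (n :* n)
                := (:- (con 0ℚ :+ m)) :* (con 0ℚ :- m :* ((con 0ℚ :+ n) :* (con 0ℚ :+ n)))) refl m n) e₀)
      where
      m≢0 : m ≢ 0ℚ
      m≢0 e = x≢-m (sym (cong -_ e))
      n≢0 : n ≢ 0ℚ
      n≢0 e = x≢-n (sym (cong -_ e))

    base-eq : ∀ c → 1ℚ * 1ℚ + c * (0ℚ * 0ℚ) ≡ 1ℚ
    base-eq c = cong (1ℚ +_) (*-zeroʳ c)

  -- The formulas all vanish exactly at ∞, (-m,0) and (-n,0), where
  -- the extension takes the limit value: with x = -m + t one has
  -- y² ~ m (m - n) t and the formulas are ~ m (n - m)² t (1 : 0 : -1 : 1);
  -- likewise (1 : 0 : 1 : -1) at (-n,0), and (1 : 0 : 1 : 1) at ∞.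
  ψ : E m n → Q m n
  ψ ∞ = mkQ 1ℚ 0ℚ 1ℚ 1ℚ (λ ()) (base-eq m) (base-eq n)
  ψ (aff x y h) with x ≟ - m | x ≟ - n
  ... | yes _    | _        = mkQ 1ℚ 0ℚ (- 1ℚ) 1ℚ (λ ()) (base-eq m) (base-eq n)
  ... | no _     | yes _    = mkQ 1ℚ 0ℚ 1ℚ (- 1ℚ) (λ ()) (base-eq m) (base-eq n)
  ... | no x≢-m | no x≢-n =
        mkQ (ψ₀ x y) (ψ₁ x y) (ψ₂ x y) (ψ₃ x y)
            (ψ-nonzero x y h x≢-m x≢-n) (ψ-eqₘ x y) (ψ-eqₙ x y h)

record IsTriangle (a b c : ℚ) : Set where
  field
    a>0   : 0ℚ < a
    b>0   : 0ℚ < b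
    c>0   : 0ℚ < c
    c<a+b : c < a + b
    a<b+c : a < b + c
    b<c+a : b < c + a

-- The cosine of the angle between the sides a and b, by the law of
-- cosines c² = a² + b² - 2 a b cos θ.
cosAngle : (a b c : ℚ) → IsTriangle a b c → ℚ
cosAngle a b c Δ = ((a * a + b * b - c * c) ÷ (2ℚ * a * b)) {{≢-nonZero 2ab≢0}}
  where
  open IsTriangle Δ
  2ab≢0 : 2ℚ * a * b ≢ 0ℚ
  2ab≢0 = *-≢0 (2ℚ * a) b (*-≢0 2ℚ a (λ ()) (λ e → <⇒≢ a>0 (sym e))) (λ e → <⇒≢ b>0 (sym e))

[q-p]/[q+p] : (p q : ℕ) → 0 ℕ.< p → ℚ
[q-p]/[q+p] p q 0<p =
  ((ℤ.+ q ℤ.- ℤ.+ p) / (q ℕ.+ p)) {{ℕ.>-nonZero (m≤n⇒m≤o+n q 0<p)}}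

module Attached {m n : ℚ} (X : Q m n) (X₁≢0 : Q.X₁ X ≢ 0ℚ) where
  open Q X

  private instance
    X₁-nonZero : NonZero X₁
    X₁-nonZero = ≢-nonZero X₁≢0

  α β γ a b c : ℚ
  α = X₂ ÷ X₁
  β = X₀ ÷ X₁
  γ = X₃ ÷ X₁
  a = ∣ γ ∣ + ∣ α ∣
  b = ∣ γ ∣ - ∣ α ∣
  c = 2ℚ * ∣ β ∣

{-# OPTIONS --safe #-}

-- Let s be the tangent slope at P = (x , y), so that 2P = (x₂ , y₂) with
-- x₂ = s² - (m + n) - 2 x.  The curve Q is built so that x₂ = β², x₂ + m = α²
-- and x₂ + n = γ²; hence y₂ = ± α β γ.  As m < 0 < n, the equations of Q make
-- β² and γ² positive, so y₂ = 0 exactly when α = 0.  It remains to see that P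
-- has order 4 exactly when y₂ = 0, and this is done without associativity of
-- the group law: 4P = P ⊕ (P ⊕ 2P) vanishes iff the chord slope r of P and 2P
-- satisfies r² = s², and multiplying by (x₂ - x)² turns this into
-- (y₂ - y)² = (y₂ + y)².
module Submission where

open import Defs
open import Algebra.Properties.Group using (x∙y⁻¹≈ε⇒x≈y; x≈y⇒x∙y⁻¹≈ε)
open import Data.Empty using (⊥-elim)
open import Data.Integer.Base as ℤ using ()
import Data.Integer.Properties as ℤ
open import Data.Nat.Base as ℕ using (ℕ; suc; z≤n; s≤s)
open import Data.Nat.Coprimality using (Coprime)
import Data.Nat.Properties as ℕ
open import Data.Product.Base using (Σ-syntax; _×_; _,_; proj₁; proj₂)
open import Data.Rational.Base using (ℚ; 0ℚ; _+_; _*_; _-_; -_; _≤_; _<_; _/_; _÷_; 1/_; ∣_∣; NonZero; ≢-nonZero; toℚᵘ)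
open import Data.Rational.Properties
open import Data.Rational.Solver using (module +-*-Solver)
open import Data.Rational.Unnormalised.Base as ℚᵘ using (mkℚᵘ; *≡*)
import Data.Rational.Unnormalised.Properties as ℚᵘ
open import Data.Sum.Base using (_⊎_; inj₁; inj₂; [_,_]′)
open import Function.Base using (_∘_; case_of_)
open import Function.Bundles using (_⇔_; mk⇔; module Equivalence)
open import Relation.Binary.PropositionalEquality
open import Relation.Nullary using (yes; no)
open import Relation.Nullary.Decidable using (recompute)

open +-*-Solver using (solve; _:=_; _:+_; _:*_; :-_; _:-_; con)

-- Field arithmetic

-≡0⇒≡ : ∀ {x y} → x - y ≡ 0ℚ → x ≡ y
-≡0⇒≡ = x∙y⁻¹≈ε⇒x≈y +-0-group _ _

≡⇒-≡0 : ∀ {x y} → x ≡ y → x - y ≡ 0ℚ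
≡⇒-≡0 = x≈y⇒x∙y⁻¹≈ε +-0-group

÷-* : ∀ x y .{{_ : NonZero y}} → (x ÷ y) * y ≡ x
÷-* x y = trans (*-assoc x (1/ y) y)
  (trans (cong (x *_) (*-inverseˡ y)) (*-identityʳ x))

*-÷ : ∀ x y .{{_ : NonZero y}} → (x * y) ÷ y ≡ x
*-÷ x y = trans (*-assoc x y (1/ y))
  (trans (cong (x *_) (*-inverseʳ y)) (*-identityʳ x))

*-cancelʳ-≢0 : ∀ r {x y} → r ≢ 0ℚ → x * r ≡ y * r → x ≡ y
*-cancelʳ-≢0 r {x} {y} r≢0 e = begin
  x         ≡⟨ *-÷ x r ⟨
  x * r ÷ r ≡⟨ cong (_÷ r) e ⟩
  y * r ÷ r ≡⟨ *-÷ y r ⟩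
  y         ∎
  where
  open ≡-Reasoning
  instance _ = ≢-nonZero r≢0

x*y≡0⇒x≡0∨y≡0 : ∀ x y → x * y ≡ 0ℚ → x ≡ 0ℚ ⊎ y ≡ 0ℚ
x*y≡0⇒x≡0∨y≡0 x y e with y ≟ 0ℚ
... | yes y≡0 = inj₂ y≡0
... | no  y≢0 = inj₁ (*-cancelʳ-≢0 y y≢0 (trans e (sym (*-zeroˡ y))))

*-≢0 : ∀ {x y} → x ≢ 0ℚ → y ≢ 0ℚ → x * y ≢ 0ℚ
*-≢0 {x} {y} x≢0 y≢0 e with x*y≡0⇒x≡0∨y≡0 x y e
... | inj₁ x≡0 = x≢0 x≡0
... | inj₂ y≡0 = y≢0 y≡0

x*x≡0⇒x≡0 : ∀ x → x * x ≡ 0ℚ → x ≡ 0ℚ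
x*x≡0⇒x≡0 x e with x*y≡0⇒x≡0∨y≡0 x x e
... | inj₁ x≡0 = x≡0
... | inj₂ x≡0 = x≡0

x≡0⇒x*x≡0 : ∀ {x} → x ≡ 0ℚ → x * x ≡ 0ℚ
x≡0⇒x*x≡0 refl = refl

+≡0⇒≡- : ∀ x y → x + y ≡ 0ℚ → x ≡ - y
+≡0⇒≡- x y e = -≡0⇒≡ (trans (cong (x +_) (solve 1 (λ y → :- (:- y) := y) refl y)) e)

≡-⇒+≡0 : ∀ {x y} → x ≡ - y → x + y ≡ 0ℚ
≡-⇒+≡0 {y = y} refl = +-inverseˡ y

-- Squares and absolute values

∣x∣*∣x∣≡x*x : ∀ x → ∣ x ∣ * ∣ x ∣ ≡ x * x
∣x∣*∣x∣≡x*x x with ∣p∣≡p∨∣p∣≡-p x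
... | inj₁ e = cong₂ _*_ e e
... | inj₂ e = trans (cong₂ _*_ e e) (solve 1 (λ x → (:- x) :* (:- x) := x :* x) refl x)

0≤x*x : ∀ x → 0ℚ ≤ x * x
0≤x*x x = subst₂ _≤_ (*-zeroˡ ∣ x ∣) (∣x∣*∣x∣≡x*x x) (*-monoʳ-≤-nonNeg ∣ x ∣ (0≤∣p∣ x))
  where instance _ = ∣-∣-nonNeg x

x*x<y*y⇒∣x∣<∣y∣ : ∀ x y → x * x < y * y → ∣ x ∣ < ∣ y ∣
x*x<y*y⇒∣x∣<∣y∣ x y lt = ≰⇒> λ ∣y∣≤∣x∣ → <-irrefl refl (<-≤-trans lt (begin
  y * y         ≡⟨ ∣x∣*∣x∣≡x*x y ⟨
  ∣ y ∣ * ∣ y ∣ ≤⟨ *-monoʳ-≤-nonNeg ∣ y ∣ ∣y∣≤∣x∣ ⟩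
  ∣ x ∣ * ∣ y ∣ ≤⟨ *-monoˡ-≤-nonNeg ∣ x ∣ ∣y∣≤∣x∣ ⟩
  ∣ x ∣ * ∣ x ∣ ≡⟨ ∣x∣*∣x∣≡x*x x ⟩
  x * x         ∎))
  where
  open ≤-Reasoning
  instance
    _ = ∣-∣-nonNeg x
    _ = ∣-∣-nonNeg y

x<x+pos : ∀ x {d} → 0ℚ < d → x < x + d
x<x+pos x 0<d = subst (_< x + _) (+-identityʳ x) (+-monoʳ-< x 0<d)

x-pos<x : ∀ x {d} → 0ℚ < d → x - d < x
x-pos<x x 0<d = subst (x - _ <_) (+-identityʳ x) (+-monoʳ-< x (neg-antimono-< 0<d))

-- Integers as rationals

-- Arithmetic on normalised rationals reduces by a gcd. The identities below are therefore
-- transported to unnormalised fractions, where cross-multiplication settles them.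
toℚᵘ-/1 : ∀ i → toℚᵘ (i / 1) ℚᵘ.≃ mkℚᵘ i 0
toℚᵘ-/1 i = toℚᵘ-fromℚᵘ (mkℚᵘ i 0)

/1-homo-+ : ∀ i j → (i ℤ.+ j) / 1 ≡ i / 1 + j / 1
/1-homo-+ i j = toℚᵘ-injective (begin
  toℚᵘ ((i ℤ.+ j) / 1)          ≈⟨ toℚᵘ-/1 (i ℤ.+ j) ⟩
  mkℚᵘ (i ℤ.+ j) 0              ≈⟨ *≡* (cong (ℤ._* (ℤ.+ 1)) (cong₂ ℤ._+_ (ℤ.*-identityʳ i) (ℤ.*-identityʳ j))) ⟨
  mkℚᵘ i 0 ℚᵘ.+ mkℚᵘ j 0        ≈⟨ ℚᵘ.+-cong (toℚᵘ-/1 i) (toℚᵘ-/1 j) ⟨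
  toℚᵘ (i / 1) ℚᵘ.+ toℚᵘ (j / 1) ≈⟨ toℚᵘ-homo-+ (i / 1) (j / 1) ⟨
  toℚᵘ (i / 1 + j / 1)          ∎)
  where open ℚᵘ.≃-Reasoning

/1-homo-* : ∀ i j → (i ℤ.* j) / 1 ≡ i / 1 * (j / 1)
/1-homo-* i j = toℚᵘ-injective (begin
  toℚᵘ ((i ℤ.* j) / 1)          ≈⟨ toℚᵘ-/1 (i ℤ.* j) ⟩
  mkℚᵘ i 0 ℚᵘ.* mkℚᵘ j 0        ≈⟨ ℚᵘ.*-cong (toℚᵘ-/1 i) (toℚᵘ-/1 j) ⟨
  toℚᵘ (i / 1) ℚᵘ.* toℚᵘ (j / 1) ≈⟨ toℚᵘ-homo-* (i / 1) (j / 1) ⟨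
  toℚᵘ (i / 1 * (j / 1))        ∎)
  where open ℚᵘ.≃-Reasoning

/1-homo-- : ∀ i j → (i ℤ.- j) / 1 ≡ i / 1 - j / 1
/1-homo-- i j = begin
  (i ℤ.- j) / 1                 ≡⟨ solve 2 (λ a b → a := a :+ b :- b) refl ((i ℤ.- j) / 1) (j / 1) ⟩
  (i ℤ.- j) / 1 + j / 1 - j / 1 ≡⟨ cong (_- j / 1) (/1-homo-+ (i ℤ.- j) j) ⟨
  (i ℤ.- j ℤ.+ j) / 1 - j / 1   ≡⟨ cong (λ a → a / 1 - j / 1) i-j+j≡i ⟩
  i / 1 - j / 1                 ∎
  where
  open ≡-Reasoning
  i-j+j≡i : i ℤ.- j ℤ.+ j ≡ i
  i-j+j≡i = trans (ℤ.+-assoc i (ℤ.- j) j) (trans (cong (λ z → i ℤ.+ z) (ℤ.+-inverseˡ j)) (ℤ.+-identityʳ i))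

-- Matching on `suc d-1` exhibits `i / d` as the image of `mkℚᵘ i d-1` under `fromℚᵘ`, so the
-- reduction to lowest terms need not be inspected.
/-*-denominator : ∀ i d .{{_ : ℕ.NonZero d}} → (i / d) * fromℕ d ≡ i / 1
/-*-denominator i d@(suc d-1) = toℚᵘ-injective (begin
  toℚᵘ (i / d * fromℕ d)           ≈⟨ toℚᵘ-homo-* (i / d) (fromℕ d) ⟩
  toℚᵘ (i / d) ℚᵘ.* toℚᵘ (fromℕ d) ≈⟨ ℚᵘ.*-cong (toℚᵘ-fromℚᵘ (mkℚᵘ i d-1)) (toℚᵘ-/1 (ℤ.+ d)) ⟩
  mkℚᵘ i d-1 ℚᵘ.* mkℚᵘ (ℤ.+ d) 0     ≈⟨ *≡* (trans (ℤ.*-identityʳ _) (cong (λ e → i ℤ.* (ℤ.+ e)) (sym (ℕ.*-identityʳ d)))) ⟩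
  mkℚᵘ i 0                         ≈⟨ toℚᵘ-/1 i ⟨
  toℚᵘ (i / 1)                     ∎)
  where open ℚᵘ.≃-Reasoning

fromℕ-homo-+ : ∀ i j → fromℕ (i ℕ.+ j) ≡ fromℕ i + fromℕ j
fromℕ-homo-+ i j = /1-homo-+ (ℤ.+ i) (ℤ.+ j)

fromℕ-homo-* : ∀ i j → fromℕ (i ℕ.* j) ≡ fromℕ i * fromℕ j
fromℕ-homo-* i j = trans (cong (_/ 1) (ℤ.pos-* i j)) (/1-homo-* (ℤ.+ i) (ℤ.+ j))

0<fromℕ : ∀ {i} → 0 ℕ.< i → 0ℚ < fromℕ i
0<fromℕ {suc i} _ = positive⁻¹ (fromℕ (suc i)) {{normalize-pos (suc i) 1}}

-- The triangle

-- The absolute values satisfy 0 ≤ A < B < C. The first two triangle inequalities amount to 2B < 2C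
-- and 2A < 2B; the third follows from B > 0 and -A ≤ A.
triangle : ∀ α β γ → α * α < β * β → β * β < γ * γ →
  IsTriangle (∣ γ ∣ + ∣ α ∣) (∣ γ ∣ - ∣ α ∣) (2ℚ * ∣ β ∣)
triangle α β γ α²<β² β²<γ² = record
  { a>0   = +-mono-<-≤ 0<C 0≤A
  ; b>0   = b>0
  ; c>0   = c>0
  ; c<a+b = subst (2ℚ * B <_) (solve 2 (λ A C → con 2ℚ :* C := C :+ A :+ (C :- A)) refl A C)
              (*-monoʳ-<-pos 2ℚ B<C)
  ; a<b+c = subst (_< C - A + 2ℚ * B) (solve 2 (λ A C → C :- A :+ con 2ℚ :* A := C :+ A) refl A C)
              (+-monoʳ-< (C - A) (*-monoʳ-<-pos 2ℚ A<B))
  ; b<c+a = <-≤-trans (subst (_< 2ℚ * B + (C - A)) (+-identityˡ (C - A)) (+-monoˡ-< (C - A) c>0))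
              (+-monoʳ-≤ (2ℚ * B) (+-monoʳ-≤ C (≤-trans (neg-antimono-≤ 0≤A) 0≤A)))
  }
  where
  A = ∣ α ∣
  B = ∣ β ∣
  C = ∣ γ ∣
  A<B : A < B
  A<B = x*x<y*y⇒∣x∣<∣y∣ α β α²<β²
  B<C : B < C
  B<C = x*x<y*y⇒∣x∣<∣y∣ β γ β²<γ²
  0≤A : 0ℚ ≤ A
  0≤A = 0≤∣p∣ α
  0<C : 0ℚ < C
  0<C = ≤-<-trans 0≤A (<-trans A<B B<C)
  b>0 : 0ℚ < C - A
  b>0 = subst (_< C - A) (+-inverseʳ A) (+-monoˡ-< (- A) (<-trans A<B B<C))
  c>0 : 0ℚ < 2ℚ * B
  c>0 = *-monoʳ-<-pos 2ℚ (≤-<-trans 0≤A A<B)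

-- With α² = β² - M and γ² = β² + N one has a² + b² - c² = 2 (N - M) and
-- 2 a b = 2 (N + M).
cosAngle-value : ∀ {α β γ M N} r → α * α ≡ β * β - M → γ * γ ≡ β * β + N →
  r * (N + M) ≡ N - M →
  (Δ : IsTriangle (∣ γ ∣ + ∣ α ∣) (∣ γ ∣ - ∣ α ∣) (2ℚ * ∣ β ∣)) →
  cosAngle (∣ γ ∣ + ∣ α ∣) (∣ γ ∣ - ∣ α ∣) (2ℚ * ∣ β ∣) Δ ≡ r
cosAngle-value {α} {β} {γ} {M} {N} r α²≡ γ²≡ r≡ Δ =
  trans (cong (λ z → (z ÷ (2ℚ * a * b)) {{2ab-nonZero}}) num≡) (*-÷ r (2ℚ * a * b) {{2ab-nonZero}})
  where
  open ≡-Reasoning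
  A = ∣ α ∣
  B = ∣ β ∣
  C = ∣ γ ∣
  a = C + A
  b = C - A
  c = 2ℚ * B
  2ab-nonZero : NonZero (2ℚ * a * b)
  2ab-nonZero = ≢-nonZero (*-≢0 (*-≢0 {2ℚ} (λ ()) (≢-sym (<⇒≢ (IsTriangle.a>0 Δ)))) (≢-sym (<⇒≢ (IsTriangle.b>0 Δ))))
  A²≡ : A * A ≡ β * β - M
  A²≡ = trans (∣x∣*∣x∣≡x*x α) α²≡
  C²≡ : C * C ≡ β * β + N
  C²≡ = trans (∣x∣*∣x∣≡x*x γ) γ²≡
  num≡ : a * a + b * b - c * c ≡ r * (2ℚ * a * b)
  num≡ = begin
    a * a + b * b - c * c
      ≡⟨ solve 3 (λ A B C → (C :+ A) :* (C :+ A) :+ (C :- A) :* (C :- A) :- (con 2ℚ :* B) :* (con 2ℚ :* B)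
           := con 2ℚ :* (C :* C :+ A :* A :- con 2ℚ :* (B :* B))) refl A B C ⟩
    2ℚ * (C * C + A * A - 2ℚ * (B * B))
      ≡⟨ cong₂ (λ u v → 2ℚ * (u - 2ℚ * v)) (cong₂ _+_ C²≡ A²≡) (∣x∣*∣x∣≡x*x β) ⟩
    2ℚ * (β * β + N + (β * β - M) - 2ℚ * (β * β))
      ≡⟨ solve 3 (λ β M N → con 2ℚ :* (β :* β :+ N :+ (β :* β :- M) :- con 2ℚ :* (β :* β))
           := con 2ℚ :* (N :- M)) refl β M N ⟩
    2ℚ * (N - M)
      ≡⟨ cong (2ℚ *_) r≡ ⟨
    2ℚ * (r * (N + M))
      ≡⟨ solve 4 (λ β M N r → con 2ℚ :* (r :* (N :+ M))
           := r :* (con 2ℚ :* (β :* β :+ N :- (β :* β :- M)))) refl β M N r ⟩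
    r * (2ℚ * (β * β + N - (β * β - M)))
      ≡⟨ cong₂ (λ u v → r * (2ℚ * (u - v))) C²≡ A²≡ ⟨
    r * (2ℚ * (C * C - A * A))
      ≡⟨ solve 3 (λ A C r → r :* (con 2ℚ :* (C :* C :- A :* A))
           := r :* (con 2ℚ :* (C :+ A) :* (C :- A))) refl A C r ⟩
    r * (2ℚ * a * b) ∎

-- This is the equation that `cosAngle-value` asks of r, with M = pk and N = qk: the quotient (q -
-- p)/(q + p) is cleared of its denominator and both sides are scaled by k.
[q-p]/[q+p]-spec : ∀ p q k (0<p : 0 ℕ.< p) →
  [q-p]/[q+p] p q 0<p * (fromℕ (q ℕ.* k) + fromℕ (p ℕ.* k)) ≡ fromℕ (q ℕ.* k) - fromℕ (p ℕ.* k)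
[q-p]/[q+p]-spec p q k 0<p = begin
  r * (fromℕ (q ℕ.* k) + fromℕ (p ℕ.* k))
    ≡⟨ cong₂ (λ u v → r * (u + v)) (fromℕ-homo-* q k) (fromℕ-homo-* p k) ⟩
  r * (fromℕ q * fromℕ k + fromℕ p * fromℕ k)
    ≡⟨ solve 4 (λ r p q k → r :* (q :* k :+ p :* k) := r :* (q :+ p) :* k) refl r (fromℕ p) (fromℕ q) (fromℕ k) ⟩
  r * (fromℕ q + fromℕ p) * fromℕ k
    ≡⟨ cong (λ u → r * u * fromℕ k) (fromℕ-homo-+ q p) ⟨
  r * fromℕ (q ℕ.+ p) * fromℕ k
    ≡⟨ cong (_* fromℕ k) (trans (/-*-denominator (ℤ.+ q ℤ.- ℤ.+ p) (q ℕ.+ p) {{q+p-nonZero}}) (/1-homo-- (ℤ.+ q) (ℤ.+ p))) ⟩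
  (fromℕ q - fromℕ p) * fromℕ k
    ≡⟨ solve 3 (λ p q k → (q :- p) :* k := q :* k :- p :* k) refl (fromℕ p) (fromℕ q) (fromℕ k) ⟩
  fromℕ q * fromℕ k - fromℕ p * fromℕ k
    ≡⟨ cong₂ _-_ (fromℕ-homo-* q k) (fromℕ-homo-* p k) ⟨
  fromℕ (q ℕ.* k) - fromℕ (p ℕ.* k) ∎
  where
  open ≡-Reasoning
  r = [q-p]/[q+p] p q 0<p
  q+p-nonZero : ℕ.NonZero (q ℕ.+ p)
  q+p-nonZero = ℕ.>-nonZero (ℕ.m≤n⇒m≤o+n q 0<p)

-- The two sides differ by 2∣α∣.
isosceles⇔ : ∀ α γ → (α * α ≡ 0ℚ) ⇔ (∣ γ ∣ + ∣ α ∣ ≡ ∣ γ ∣ - ∣ α ∣)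
isosceles⇔ α γ = mk⇔ to from
  where
  to : α * α ≡ 0ℚ → ∣ γ ∣ + ∣ α ∣ ≡ ∣ γ ∣ - ∣ α ∣
  to e = cong (λ z → ∣ γ ∣ + z) (trans ∣α∣≡0 (sym (cong -_ ∣α∣≡0)))
    where
    ∣α∣≡0 : ∣ α ∣ ≡ 0ℚ
    ∣α∣≡0 = cong ∣_∣ (x*x≡0⇒x≡0 α e)
  from : ∣ γ ∣ + ∣ α ∣ ≡ ∣ γ ∣ - ∣ α ∣ → α * α ≡ 0ℚ
  from e = x≡0⇒x*x≡0 (∣p∣≡0⇒p≡0 α (*-cancelʳ-≢0 2ℚ (λ ())
    (trans (solve 2 (λ A C → A :* con 2ℚ := C :+ A :- (C :- A)) refl ∣ α ∣ ∣ γ ∣) (≡⇒-≡0 e))))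

-- The group law

module _ {m n : ℚ} where

  -- Equality of rationals is decidable, so the curve equation can be recovered from its irrelevant
  -- copy inside a point.
  relevant : ∀ {x y} → .(OnE m n x y) → OnE m n x y
  relevant = recompute (_ ≟ _)

  OnE⇒y≡0 : ∀ {x y} → OnE m n x y → x * (x + m) * (x + n) ≡ 0ℚ → y ≡ 0ℚ
  OnE⇒y≡0 {y = y} h e = x*x≡0⇒x≡0 y (trans h e)

  -- The equation of an affine point is irrelevant, so it has to be recomputed
  -- before it can be stored in a Σ-type.
  IsAff : E m n → ℚ → ℚ → Set
  IsAff P x y = Σ[ h ∈ OnE m n x y ] P ≡ aff x y h

  isAff : ∀ {x y} .(h : OnE m n x y) → IsAff (aff x y h) x y
  isAff {x} {y} h = relevant {x} {y} h , refl

  aff≢∞ : ∀ {x y} .{h : OnE m n x y} → aff x y h ≢ ∞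
  aff≢∞ ()

  aff-cong : ∀ {x₁ y₁ x₂ y₂} .(h₁ : OnE m n x₁ y₁) .(h₂ : OnE m n x₂ y₂) →
    x₁ ≡ x₂ → y₁ ≡ y₂ → aff x₁ y₁ h₁ ≡ aff x₂ y₂ h₂
  aff-cong _ _ refl refl = refl

  -- Among the branches of `_⊕_` for affine points, only the one for a vertical line returns `∞`.
  -- The vanishing of a sum thus becomes two equations between coordinates.
  ⊕≡∞⇒opposite : ∀ {x₁ y₁ x₂ y₂} .(h₁ : OnE m n x₁ y₁) .(h₂ : OnE m n x₂ y₂) →
    aff x₁ y₁ h₁ ⊕ aff x₂ y₂ h₂ ≡ ∞ → x₁ ≡ x₂ × y₁ ≡ - y₂
  ⊕≡∞⇒opposite {x₁} {y₁} {x₂} {y₂} h₁ h₂ e with x₁ ≟ x₂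
  ... | no _ = case e of λ ()
  ... | yes x₁≡x₂ with y₁ ≟ - y₂
  ...   | yes y₁≡-y₂ = x₁≡x₂ , y₁≡-y₂
  ...   | no _ = case e of λ ()

  opposite⇒⊕≡∞ : ∀ {x₁ y₁ x₂ y₂} .(h₁ : OnE m n x₁ y₁) .(h₂ : OnE m n x₂ y₂) →
    x₁ ≡ x₂ → y₁ ≡ - y₂ → aff x₁ y₁ h₁ ⊕ aff x₂ y₂ h₂ ≡ ∞
  opposite⇒⊕≡∞ {x₁} {y₁} {x₂} {y₂} h₁ h₂ x₁≡x₂ y₁≡-y₂ with x₁ ≟ x₂
  ... | no x₁≢x₂ = ⊥-elim (x₁≢x₂ x₁≡x₂)
  ... | yes _ with y₁ ≟ - y₂
  ...   | yes _ = refl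
  ...   | no y₁≢-y₂ = ⊥-elim (y₁≢-y₂ y₁≡-y₂)

  -- The slope is handed on with its equation cleared of denominators, so that later arguments about
  -- it are polynomial identities.
  ⊕-chord : ∀ {x₁ y₁ x₂ y₂} .(h₁ : OnE m n x₁ y₁) .(h₂ : OnE m n x₂ y₂) → x₁ ≢ x₂ →
    Σ[ s ∈ ℚ ] s * (x₂ - x₁) ≡ y₂ - y₁ ×
      IsAff (aff x₁ y₁ h₁ ⊕ aff x₂ y₂ h₂) (sumX {m} {n} x₁ x₂ s) (sumY {m} {n} x₁ x₂ y₁ s)
  ⊕-chord {x₁} {y₁} {x₂} {y₂} h₁ h₂ x₁≢x₂ with x₁ ≟ x₂
  ... | yes x₁≡x₂ = ⊥-elim (x₁≢x₂ x₁≡x₂)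
  ... | no x₁≢x₂′ = chordSlope {m} {n} x₁ y₁ x₂ y₂ x₁≢x₂′ ,
        ÷-* (y₂ - y₁) (x₂ - x₁) {{≢-nonZero (x₁≢x₂ ∘ sym ∘ -≡0⇒≡)}} ,
        isAff _

  ⊕-tangent : ∀ {x y} .(h : OnE m n x y) → y ≢ 0ℚ →
    Σ[ s ∈ ℚ ] s * (2ℚ * y) ≡ 3ℚ * x * x + 2ℚ * (m + n) * x + m * n ×
      IsAff (aff x y h ⊕ aff x y h) (sumX {m} {n} x x s) (sumY {m} {n} x x y s)
  ⊕-tangent {x} {y} h y≢0 with x ≟ x
  ... | no x≢x = ⊥-elim (x≢x refl)
  ... | yes _ with y ≟ - y
  ...   | no _ = tangentSlope {m} {n} x y y≢0 ,
          ÷-* (3ℚ * x * x + 2ℚ * (m + n) * x + m * n) (2ℚ * y) {{≢-nonZero (*-≢0 {2ℚ} (λ ()) y≢0)}} ,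
          isAff _
  ...   | yes y≡-y = ⊥-elim (y≢0 (*-cancelʳ-≢0 2ℚ (λ ())
          (trans (solve 1 (λ y → y :* con 2ℚ := y :+ y) refl y) (≡-⇒+≡0 y≡-y))))

  -- Doubling and points of order 4.

  module Doubling {x y : ℚ} .(h : OnE m n x y) (y≢0 : y ≢ 0ℚ)
    (s : ℚ) (s-spec : s * (2ℚ * y) ≡ 3ℚ * x * x + 2ℚ * (m + n) * x + m * n)
    (2P-isAff : IsAff (aff x y h ⊕ aff x y h) (sumX {m} {n} x x s) (sumY {m} {n} x x y s))
    where

    x₂ y₂ : ℚ
    x₂ = sumX {m} {n} x x s
    y₂ = sumY {m} {n} x x y s

    P : E m n
    P = aff x y h

    h₂ : OnE m n x₂ y₂
    h₂ = proj₁ 2P-isAff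

    2P≡ : P ⊕ P ≡ aff x₂ y₂ h₂
    2P≡ = proj₂ 2P-isAff

    -- This is the case 2P = -P: in y₂ = s (x - x₂) - y the first term vanishes.
    x≡x₂⇒y≡-y₂ : x ≡ x₂ → y ≡ - y₂
    x≡x₂⇒y≡-y₂ e = begin
      y                    ≡⟨ solve 2 (λ y s → y := :- (s :* con 0ℚ :- y)) refl y s ⟩
      - (s * 0ℚ - y)       ≡⟨ cong (λ d → - (s * d - y)) (≡⇒-≡0 e) ⟨
      - (s * (x - x₂) - y) ∎
      where open ≡-Reasoning

    y₂≡0⇒x≢x₂ : y₂ ≡ 0ℚ → x ≢ x₂
    y₂≡0⇒x≢x₂ y₂≡0 e = y≢0 (trans (x≡x₂⇒y≡-y₂ e) (cong -_ y₂≡0))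

    module Chord (x≢x₂ : x ≢ x₂)
      (r : ℚ) (r-spec : r * (x₂ - x) ≡ y₂ - y)
      (3P-isAff : IsAff (P ⊕ aff x₂ y₂ h₂) (sumX {m} {n} x x₂ r) (sumY {m} {n} x x₂ y r))
      where

      x₃ y₃ : ℚ
      x₃ = sumX {m} {n} x x₂ r
      y₃ = sumY {m} {n} x x₂ y r

      h₃ : OnE m n x₃ y₃
      h₃ = proj₁ 3P-isAff

      3P≡ : P ⊕ aff x₂ y₂ h₂ ≡ aff x₃ y₃ h₃
      3P≡ = proj₂ 3P-isAff

      -- Put d = x₂ - x. Then s d = -(y₂ + y) and r d = y₂ - y, so (s d)² - (r d)² = 4 y y₂. On the
      -- other hand s² - r² = x - x₃ by the formulas for x₂ and x₃.
      x≡x₃⇒y₂≡0 : x ≡ x₃ → y₂ ≡ 0ℚ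
      x≡x₃⇒y₂≡0 e = *-cancelʳ-≢0 (2ℚ * 2ℚ * y) (*-≢0 {2ℚ * 2ℚ} (λ ()) y≢0) (begin
        y₂ * (2ℚ * 2ℚ * y)
          ≡⟨ solve 4 (λ s x y x₂ →
               let y₂ = s :* (x :- x₂) :- y in
               y₂ :* (con 2ℚ :* con 2ℚ :* y)
               := (s :* (x₂ :- x)) :* (s :* (x₂ :- x)) :- (y₂ :- y) :* (y₂ :- y)) refl s x y x₂ ⟩
        (s * (x₂ - x)) * (s * (x₂ - x)) - (y₂ - y) * (y₂ - y)
          ≡⟨ cong (λ z → (s * (x₂ - x)) * (s * (x₂ - x)) - z * z) r-spec ⟨
        (s * (x₂ - x)) * (s * (x₂ - x)) - (r * (x₂ - x)) * (r * (x₂ - x))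
          ≡⟨ solve 6 (λ m n s x r d →
               (s :* d) :* (s :* d) :- (r :* d) :* (r :* d)
               := (x :- (r :* r :- (m :+ n) :- x :- (s :* s :- (m :+ n) :- x :- x))) :* (d :* d))
               refl m n s x r (x₂ - x) ⟩
        (x - x₃) * ((x₂ - x) * (x₂ - x))
          ≡⟨ cong (_* ((x₂ - x) * (x₂ - x))) (≡⇒-≡0 e) ⟩
        0ℚ * ((x₂ - x) * (x₂ - x))
          ≡⟨ trans (*-zeroˡ ((x₂ - x) * (x₂ - x))) (sym (*-zeroˡ (2ℚ * 2ℚ * y))) ⟩
        0ℚ * (2ℚ * 2ℚ * y) ∎)
        where open ≡-Reasoning

      -- The tangent at P passes through -2P. If y₂ = 0 then -2P = 2P, so the chord through P and 2P
      -- is that tangent.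
      y₂≡0⇒r≡s : y₂ ≡ 0ℚ → r ≡ s
      y₂≡0⇒r≡s y₂≡0 = *-cancelʳ-≢0 (x₂ - x) (x≢x₂ ∘ sym ∘ -≡0⇒≡) (begin
        r * (x₂ - x)           ≡⟨ r-spec ⟩
        -- Zero is its own negative, which moves from 2P to the third point (x₂ , -y₂) of the
        -- tangent.
        y₂ - y                 ≡⟨ cong (_- y) (trans y₂≡0 (cong -_ (sym y₂≡0))) ⟩
        - y₂ - y               ≡⟨ solve 4 (λ s x y x₂ → :- (s :* (x :- x₂) :- y) :- y := s :* (x₂ :- x)) refl s x y x₂ ⟩
        s * (x₂ - x)           ∎)
        where open ≡-Reasoning

      -- In general x₃ = x + r² - s².
      r≡s⇒x≡x₃ : r ≡ s → x ≡ x₃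
      r≡s⇒x≡x₃ e = begin
        x                                 ≡⟨ solve 4 (λ m n s x → x := s :* s :- (m :+ n) :- x :- (s :* s :- (m :+ n) :- x :- x)) refl m n s x ⟩
        s * s - (m + n) - x - x₂ ≡⟨ cong (λ z → z * z - (m + n) - x - x₂) e ⟨
        x₃ ∎
        where open ≡-Reasoning

      x≡x₃⇒y≡-y₃ : x ≡ x₃ → y ≡ - y₃
      x≡x₃⇒y≡-y₃ e = begin
        y                    ≡⟨ solve 2 (λ y r → y := :- (r :* con 0ℚ :- y)) refl y r ⟩
        - (r * 0ℚ - y)       ≡⟨ cong (λ d → - (r * d - y)) (≡⇒-≡0 e) ⟨
        - (r * (x - x₃) - y) ∎
        where open ≡-Reasoning

    4P≡∞⇒y₂≡0 : 4 · P ≡ ∞ → y₂ ≡ 0ℚ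
    4P≡∞⇒y₂≡0 e = case x ≟ x₂ of λ where
        -- Here 2P = -P, hence 3P = ∞ and 4P = P ⊕ ∞, which is the affine point P.
        (yes x≡x₂) → ⊥-elim (aff≢∞ (trans
          (cong (P ⊕_) (sym (opposite⇒⊕≡∞ h h₂ x≡x₂ (x≡x₂⇒y≡-y₂ x≡x₂)))) e′))
        (no x≢x₂) → let (r , r-spec , 3P-isAff) = ⊕-chord {x} {y} {x₂} {y₂} h h₂ x≢x₂
                        open Chord x≢x₂ r r-spec 3P-isAff in
          x≡x₃⇒y₂≡0 (proj₁ (⊕≡∞⇒opposite h h₃ (trans (cong (P ⊕_) (sym 3P≡)) e′)))
      where
      -- The innermost summand `P ⊕ ∞` of `4 · P` computes to `P`, so only `P ⊕ P` has to be
      -- rewritten.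
      e′ : P ⊕ (P ⊕ aff x₂ y₂ h₂) ≡ ∞
      e′ = trans (cong (λ R → P ⊕ (P ⊕ R)) (sym 2P≡)) e

    -- Since the chord is the tangent, 3P has the abscissa of P and ordinate -y, whence 4P = ∞. The
    -- multiples P, 2P and 3P all come with affine coordinates.
    y₂≡0⇒order4 : y₂ ≡ 0ℚ → HasOrder P 4
    y₂≡0⇒order4 y₂≡0 = s≤s z≤n , 4P≡∞ , smaller
      where
      x≢x₂ : x ≢ x₂
      x≢x₂ = y₂≡0⇒x≢x₂ y₂≡0
      chord = ⊕-chord {x} {y} {x₂} {y₂} h h₂ x≢x₂
      open Chord x≢x₂ (proj₁ chord) (proj₁ (proj₂ chord)) (proj₂ (proj₂ chord))
      x≡x₃ : x ≡ x₃
      x≡x₃ = r≡s⇒x≡x₃ (y₂≡0⇒r≡s y₂≡0)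
      3·P≡ : 3 · P ≡ aff x₃ y₃ h₃
      3·P≡ = trans (cong (P ⊕_) 2P≡) 3P≡
      4P≡∞ : 4 · P ≡ ∞
      4P≡∞ = trans (cong (P ⊕_) 3·P≡) (opposite⇒⊕≡∞ h h₃ x≡x₃ (x≡x₃⇒y≡-y₃ x≡x₃))
      smaller : ∀ j → 0 ℕ.< j → j ℕ.< 4 → j · P ≢ ∞
      smaller 1 _ _ e = aff≢∞ e
      smaller 2 _ _ e = aff≢∞ (trans (sym 2P≡) e)
      smaller 3 _ _ e = aff≢∞ (trans (sym 3·P≡) e)
      smaller (suc (suc (suc (suc _)))) _ (s≤s (s≤s (s≤s (s≤s ()))))

    order4⇔y₂≡0 : HasOrder P 4 ⇔ y₂ ≡ 0ℚ
    order4⇔y₂≡0 = mk⇔ (λ (_ , e , _) → 4P≡∞⇒y₂≡0 e) y₂≡0⇒order4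

    -- On the curve y² - m (x + n)² = (x + n)(x² - mn), so that ψ₀ / ψ₁ = -(x² - mn) / (2y). Its
    -- square is the classical duplication formula for the abscissa of 2P.
    x₂≡β² : ∀ β → ψ₁ m n x y ≢ 0ℚ → β * ψ₁ m n x y ≡ ψ₀ m n x y → x₂ ≡ β * β
    x₂≡β² β ψ₁≢0 β-spec = *-cancelʳ-≢0 (p₁ * p₁) (*-≢0 ψ₁≢0 ψ₁≢0) (begin
      x₂ * (p₁ * p₁)
        -- The factor ψ₁² contains (2y)², so s can be grouped into s · 2y, the quantity that the
        -- tangent equation evaluates.
        ≡⟨ solve 5 (λ m n x y s →
             let u = x :+ m
                 v = x :+ n
                 p₁ = con 2ℚ :* y :* v :* u
             in (s :* s :- (m :+ n) :- x :- x) :* (p₁ :* p₁)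
                := u :* u :* (v :* v) :* ((s :* (con 2ℚ :* y)) :* (s :* (con 2ℚ :* y))
                   :- (m :+ n :+ x :+ x) :* (con 2ℚ :* con 2ℚ) :* (y :* y)))
             refl m n x y s ⟩
      u * u * (v * v) * ((s * (2ℚ * y)) * (s * (2ℚ * y)) - (m + n + x + x) * (2ℚ * 2ℚ) * (y * y))
        ≡⟨ cong₂ (λ f z → u * u * (v * v) * (f * f - (m + n + x + x) * (2ℚ * 2ℚ) * z))
             s-spec h′ ⟩
      u * u * (v * v) * (F * F - (m + n + x + x) * (2ℚ * 2ℚ) * (x * u * v))
        -- With s and y eliminated, the core of this identity is F² - 4 (m + n + 2x) x u v = (x² -
        -- mn)².
        ≡⟨ solve 3 (λ m n x →
             let u = x :+ m
                 v = x :+ n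
                 F = con 3ℚ :* x :* x :+ con 2ℚ :* (m :+ n) :* x :+ m :* n
                 w = (:- u) :* (x :* u :* v :- m :* (v :* v))
             in u :* u :* (v :* v) :* (F :* F :- (m :+ n :+ x :+ x) :* (con 2ℚ :* con 2ℚ) :* (x :* u :* v))
                := w :* w)
             refl m n x ⟩
      (- u * (x * u * v - m * (v * v))) * (- u * (x * u * v - m * (v * v)))
        ≡⟨ cong (λ z → (- u * (z - m * (v * v))) * (- u * (z - m * (v * v)))) h′ ⟨
      ψ₀ m n x y * ψ₀ m n x y
        ≡⟨ cong₂ _*_ β-spec β-spec ⟨
      (β * p₁) * (β * p₁)
        ≡⟨ solve 2 (λ β p → (β :* p) :* (β :* p) := β :* β :* (p :* p)) refl β p₁ ⟩
      β * β * (p₁ * p₁) ∎)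
      where
      open ≡-Reasoning
      u = x + m
      v = x + n
      F = 3ℚ * x * x + 2ℚ * (m + n) * x + m * n
      p₁ = ψ₁ m n x y
      h′ : y * y ≡ x * (x + m) * (x + n)
      h′ = relevant {x} {y} h

    -- y₂² = x₂ (x₂ + m) (x₂ + n) = β² α² γ².
    order4⇔α²≡0 : ∀ {A B C} → x₂ ≡ B → A ≡ B + m → C ≡ B + n → B ≢ 0ℚ → C ≢ 0ℚ →
      HasOrder P 4 ⇔ A ≡ 0ℚ
    order4⇔α²≡0 {A} {B} {C} x₂≡B A≡ C≡ B≢0 C≢0 =
      mk⇔ (to ∘ Equivalence.to order4⇔y₂≡0) (Equivalence.from order4⇔y₂≡0 ∘ from)
      where
      open ≡-Reasoning
      y₂²≡ : y₂ * y₂ ≡ B * A * C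
      y₂²≡ = begin
        y₂ * y₂                    ≡⟨ h₂ ⟩
        x₂ * (x₂ + m) * (x₂ + n)   ≡⟨ cong (λ z → z * (z + m) * (z + n)) x₂≡B ⟩
        B * (B + m) * (B + n)      ≡⟨ cong₂ (λ a c → B * a * c) A≡ C≡ ⟨
        B * A * C                  ∎
      to : y₂ ≡ 0ℚ → A ≡ 0ℚ
      to e with x*y≡0⇒x≡0∨y≡0 (B * A) C (trans (sym y₂²≡) (x≡0⇒x*x≡0 e))
      ... | inj₂ C≡0 = ⊥-elim (C≢0 C≡0)
      ... | inj₁ BA≡0 with x*y≡0⇒x≡0∨y≡0 B A BA≡0
      ...   | inj₁ B≡0 = ⊥-elim (B≢0 B≡0)
      ...   | inj₂ A≡0 = A≡0
      from : A ≡ 0ℚ → y₂ ≡ 0ℚ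
      from e = x*x≡0⇒x≡0 y₂ (begin
        y₂ * y₂    ≡⟨ y₂²≡ ⟩
        B * A * C  ≡⟨ cong (λ a → B * a * C) e ⟩
        B * 0ℚ * C ≡⟨ solve 2 (λ b c → b :* con 0ℚ :* c := con 0ℚ) refl B C ⟩
        0ℚ         ∎)

  order4⇔ : ∀ {x y} .(h : OnE m n x y) → y ≢ 0ℚ → ψ₁ m n x y ≢ 0ℚ →
    ∀ {A β C} → β * ψ₁ m n x y ≡ ψ₀ m n x y → A ≡ β * β + m → C ≡ β * β + n →
    β * β ≢ 0ℚ → C ≢ 0ℚ → HasOrder (aff x y h) 4 ⇔ A ≡ 0ℚ
  order4⇔ {x} {y} h y≢0 ψ₁≢0 {β = β} β-spec = order4⇔α²≡0 (x₂≡β² β ψ₁≢0 β-spec)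
    where
    tangent = ⊕-tangent {x} {y} h y≢0
    open Doubling {x} {y} h y≢0 (proj₁ tangent) (proj₁ (proj₂ tangent)) (proj₂ (proj₂ tangent))

  -- Coordinates of ψ(P) away from the 2-torsion.

  non-2-torsion⇒y≢0 : ∀ {x y} .(h : OnE m n x y) → let P = aff x y h in
    P ≢ T₀ m n → P ≢ Tₘ m n → P ≢ Tₙ m n → y ≢ 0ℚ
  non-2-torsion⇒y≢0 {x} {y} h ≢T₀ ≢Tₘ ≢Tₙ y≡0 =
    [ [ (λ e → ≢T₀ (aff-cong h _ e y≡0))
      , (λ e → ≢Tₘ (aff-cong h _ (+≡0⇒≡- x m e) y≡0)) ]′ ∘ x*y≡0⇒x≡0∨y≡0 x (x + m)
    , (λ e → ≢Tₙ (aff-cong h _ (+≡0⇒≡- x n e) y≡0)) ]′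
    (x*y≡0⇒x≡0∨y≡0 (x * (x + m)) (x + n) (trans (sym (relevant {x} {y} h)) (x≡0⇒x*x≡0 y≡0)))

  y≢0⇒x+m≢0 : ∀ {x y} → OnE m n x y → y ≢ 0ℚ → x + m ≢ 0ℚ
  y≢0⇒x+m≢0 {x} {y} h y≢0 e = y≢0 (OnE⇒y≡0 {x} {y} h (trans (cong (λ u → x * u * (x + n)) e)
    (solve 2 (λ x v → x :* con 0ℚ :* v := con 0ℚ) refl x (x + n))))

  y≢0⇒x+n≢0 : ∀ {x y} → OnE m n x y → y ≢ 0ℚ → x + n ≢ 0ℚ
  y≢0⇒x+n≢0 {x} {y} h y≢0 e = y≢0 (OnE⇒y≡0 {x} {y} h (trans (cong (x * (x + m) *_) e) (*-zeroʳ (x * (x + m)))))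

  ψ₁≢0 : ∀ {x y} → OnE m n x y → y ≢ 0ℚ → ψ₁ m n x y ≢ 0ℚ
  ψ₁≢0 {x} {y} h y≢0 = *-≢0 (*-≢0 (*-≢0 {2ℚ} (λ ()) y≢0) (y≢0⇒x+n≢0 {x} {y} h y≢0)) (y≢0⇒x+m≢0 {x} {y} h y≢0)

  -- The limit values in `ψ` occur at x = -m and x = -n, where y = 0; elsewhere the polynomial
  -- formulas apply. The first two coordinates determine β, and the equations of `Q` then give α²
  -- and γ².
  ≈ψ⇒proportional : ∀ {x y} .(h : OnE m n x y) → y ≢ 0ℚ → (X : Q m n) → X ≈ ψ m n (aff x y h) →
    Σ[ t ∈ ℚ ] t ≢ 0ℚ × Q.X₀ X ≡ t * ψ₀ m n x y × Q.X₁ X ≡ t * ψ₁ m n x y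
  ≈ψ⇒proportional {x} {y} h y≢0 X X≈ with x ≟ - m | x ≟ - n
  ... | yes x≡-m | _ = ⊥-elim (y≢0⇒x+m≢0 {x} {y} (relevant {x} {y} h) y≢0 (≡-⇒+≡0 x≡-m))
  ... | no _ | yes x≡-n = ⊥-elim (y≢0⇒x+n≢0 {x} {y} (relevant {x} {y} h) y≢0 (≡-⇒+≡0 x≡-n))
  ... | no _ | no _ = let (t , t≢0 , e₀ , e₁ , _) = X≈ in t , t≢0 , e₀ , e₁

  module _ (X : Q m n) (X₁≢0 : Q.X₁ X ≢ 0ℚ) where
    open Q X using (X₀; X₁; X₂; X₃)
    open Attached X X₁≢0

    private instance
      X₁-nonZero : NonZero X₁
      X₁-nonZero = ≢-nonZero X₁≢0

    -- Dehomogenisation by X₁² of either equation of `Q`: `c` and `Y` are m and X₂, or n and X₃.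
    ÷-square : ∀ c Y → X₀ * X₀ + c * (X₁ * X₁) ≡ Y * Y → (Y ÷ X₁) * (Y ÷ X₁) ≡ β * β + c
    ÷-square c Y e = *-cancelʳ-≢0 (X₁ * X₁) (*-≢0 X₁≢0 X₁≢0) (begin
      Y ÷ X₁ * (Y ÷ X₁) * (X₁ * X₁)     ≡⟨ solve 2 (λ z w → z :* z :* (w :* w) := z :* w :* (z :* w)) refl (Y ÷ X₁) X₁ ⟩
      Y ÷ X₁ * X₁ * (Y ÷ X₁ * X₁)       ≡⟨ cong₂ _*_ (÷-* Y X₁) (÷-* Y X₁) ⟩
      Y * Y                             ≡⟨ e ⟨
      X₀ * X₀ + c * (X₁ * X₁)           ≡⟨ cong (λ z → z * z + c * (X₁ * X₁)) (÷-* X₀ X₁) ⟨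
      β * X₁ * (β * X₁) + c * (X₁ * X₁) ≡⟨ solve 3 (λ b w c → b :* w :* (b :* w) :+ c :* (w :* w) := (b :* b :+ c) :* (w :* w)) refl β X₁ c ⟩
      (β * β + c) * (X₁ * X₁)           ∎)
      where open ≡-Reasoning

  -- The equations of `Q` are irrelevant fields, so the record is matched and they are recomputed by
  -- deciding equality in ℚ.
  α²≡β²+m : (X : Q m n) (X₁≢0 : Q.X₁ X ≢ 0ℚ) → let open Attached X X₁≢0 in α * α ≡ β * β + m
  α²≡β²+m X@(mkQ _ _ X₂ _ _ eqₘ _) X₁≢0 = ÷-square X X₁≢0 m X₂ (recompute (_ ≟ _) eqₘ)

  γ²≡β²+n : (X : Q m n) (X₁≢0 : Q.X₁ X ≢ 0ℚ) → let open Attached X X₁≢0 in γ * γ ≡ β * β + n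
  γ²≡β²+n X@(mkQ _ _ _ X₃ _ _ eqₙ) X₁≢0 = ÷-square X X₁≢0 n X₃ (recompute (_ ≟ _) eqₙ)

theorem4p6 :
    (p q k : ℕ) (0<p : 0 ℕ.< p) → 0 ℕ.< q → 0 ℕ.< k →
    Coprime p q → Squarefree k →
    let m = - fromℕ (p ℕ.* k)
        n = fromℕ (q ℕ.* k)
    in
    (P : E m n) → P ≢ ∞ → P ≢ T₀ m n → P ≢ Tₘ m n → P ≢ Tₙ m n →
    (X : Q m n) → X ≈ ψ m n P →
    Σ[ X₁≢0 ∈ Q.X₁ X ≢ 0ℚ ]
      let open Attached X X₁≢0 in
        (α * α ≡ β * β - fromℕ (p ℕ.* k))
      × (γ * γ ≡ β * β + fromℕ (q ℕ.* k))
      × (α * α ≤ β * β)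
      × (β * β < γ * γ)
      × (Σ[ Δ ∈ IsTriangle a b c ] cosAngle a b c Δ ≡ [q-p]/[q+p] p q 0<p)
      × (α * α ≡ 0ℚ ⇔ (α * α ≡ 0ℚ ⊎ β * β ≡ 0ℚ ⊎ γ * γ ≡ 0ℚ))
      × (HasOrder P 4 ⇔ α * α ≡ 0ℚ)
      × (α * α ≡ 0ℚ ⇔ a ≡ b)
theorem4p6 p q k 0<p 0<q 0<k _ _ ∞ ≢∞ = ⊥-elim (≢∞ refl)
theorem4p6 p q k 0<p 0<q 0<k _ _ (aff x y h) _ ≢T₀ ≢Tₘ ≢Tₙ X X≈ =
  X₁≢0 , α²≡ , γ²≡ , <⇒≤ α²<β² , β²<γ² ,
  (Δ , cosAngle-value {α} {β} {γ} ([q-p]/[q+p] p q 0<p) α²≡ γ²≡ ([q-p]/[q+p]-spec p q k 0<p) Δ) ,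
  -- As β² and γ² are positive, α² is the only member of the triple that can be 0.
  mk⇔ inj₁ (λ where
    (inj₁ e) → e
    (inj₂ (inj₁ e)) → ⊥-elim (β²≢0 e)
    (inj₂ (inj₂ e)) → ⊥-elim (γ²≢0 e)) ,
  order4⇔ {m} {n} {x} {y} h y≢0 ψ₁≢0′ {α * α} {β} {γ * γ} β-spec α²≡ γ²≡ β²≢0 γ²≢0 ,
  isosceles⇔ α γ
  where
  m = - fromℕ (p ℕ.* k)
  n = fromℕ (q ℕ.* k)
  y≢0 : y ≢ 0ℚ
  y≢0 = non-2-torsion⇒y≢0 {m} {n} {x} {y} h ≢T₀ ≢Tₘ ≢Tₙ
  proportional = ≈ψ⇒proportional {m} {n} {x} {y} h y≢0 X X≈
  t = proj₁ proportional
  t≢0 : t ≢ 0ℚ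
  t≢0 = proj₁ (proj₂ proportional)
  X₀≡ : Q.X₀ X ≡ t * ψ₀ m n x y
  X₀≡ = proj₁ (proj₂ (proj₂ proportional))
  X₁≡ : Q.X₁ X ≡ t * ψ₁ m n x y
  X₁≡ = proj₂ (proj₂ (proj₂ proportional))
  ψ₁≢0′ : ψ₁ m n x y ≢ 0ℚ
  ψ₁≢0′ = ψ₁≢0 {m} {n} {x} {y} (relevant {m} {n} {x} {y} h) y≢0
  X₁≢0 : Q.X₁ X ≢ 0ℚ
  X₁≢0 e = *-≢0 t≢0 ψ₁≢0′ (trans (sym X₁≡) e)
  open Attached X X₁≢0
  -- A quotient of homogeneous coordinates is independent of the representative, so the scaling
  -- factor t cancels.
  β-spec : β * ψ₁ m n x y ≡ ψ₀ m n x y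
  β-spec = *-cancelʳ-≢0 t t≢0 (begin
    β * ψ₁ m n x y * t   ≡⟨ solve 3 (λ b p t → b :* p :* t := b :* (t :* p)) refl β (ψ₁ m n x y) t ⟩
    β * (t * ψ₁ m n x y) ≡⟨ cong (β *_) X₁≡ ⟨
    β * Q.X₁ X           ≡⟨ ÷-* (Q.X₀ X) (Q.X₁ X) {{≢-nonZero X₁≢0}} ⟩
    Q.X₀ X               ≡⟨ X₀≡ ⟩
    t * ψ₀ m n x y       ≡⟨ *-comm t (ψ₀ m n x y) ⟩
    ψ₀ m n x y * t       ∎)
    where open ≡-Reasoning
  -- Since m is `- fromℕ (p ℕ.* k)`, the right-hand side is by definition β² - pk, the form in the
  -- conclusion.
  α²≡ : α * α ≡ β * β + m
  α²≡ = α²≡β²+m X X₁≢0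
  γ²≡ : γ * γ ≡ β * β + n
  γ²≡ = γ²≡β²+n X X₁≢0
  α²<β² : α * α < β * β
  α²<β² = subst (_< β * β) (sym α²≡) (x-pos<x (β * β) (0<fromℕ (ℕ.*-mono-< 0<p 0<k)))
  β²<γ² : β * β < γ * γ
  β²<γ² = subst (β * β <_) (sym γ²≡) (x<x+pos (β * β) (0<fromℕ (ℕ.*-mono-< 0<q 0<k)))
  -- Positivity comes from the chain 0 ≤ α² < β² < γ², whose strict steps are pk > 0 and qk > 0.
  0<β² : 0ℚ < β * β
  0<β² = ≤-<-trans (0≤x*x α) α²<β²
  β²≢0 : β * β ≢ 0ℚ
  β²≢0 = ≢-sym (<⇒≢ 0<β²)
  γ²≢0 : γ * γ ≢ 0ℚ
  γ²≢0 = ≢-sym (<⇒≢ (<-trans 0<β² β²<γ²))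
  Δ : IsTriangle a b c
  Δ = triangle α β γ α²<β² β²<γ²
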